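{- Let $A$ be a matrix, finite or infinite, with entries from $\mathbb Q$. (a) If $A$ is image partition regular, then $I(A)$ is a left ideal of $(\beta\mathbb N,\cdot)$. (b) If $A$ is a finite image partition regular matrix, then $I(A)$ is a two-sided ideal of $(\beta\mathbb N,\cdot)$.
   Context: $\mathbb N=\{1,2,3,\dots\}$, $\omega=\{0,1,2,\dots\}$. Matrices are $u\times v$ with $u,v\in\mathbb N\cup\{\omega\}$, and each row has only finitely many nonzero entries (so that $A\vec x$ is defined); the matrix is finite if $u,v\in\mathbb N$. $A$ is image partition regular if whenever $\mathbb N$ is finitely colored there is a vector $\vec x$ with entries from $\mathbb N$ such that all entries of $A\vec x$ lie in one color class. $\beta\mathbb N$ is the set of ultrafilters on $\mathbb N$, with multiplication given by: $U\in p\cdot q$ iff $\{x\in\mathbb N: x^{ -1}U\in q\}\in p$, where $x^{ -1}U=\{y\in\mathbb N: xy\in U\}$. $I(A)=\{p\in\beta\mathbb N:$ for every $P\in p$ there exists $\vec x$ with entries from $\mathbb N$ such that all entries of $A\vec x$ are in $P\}$. A nonempty subset $I$ of a semigroup $(T,\cdot)$ is a left ideal if $T\cdot I\subseteq I$, a right ideal if $I\cdot T\subseteq I$, and a two-sided ideal if it is both. -}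

module Defs where

open import Algebra.Bundles using (Semigroup)
open import Data.Fin.Base using (Fin)
open import Data.Integer.Base using (+_)
open import Data.List.Base using (List; foldr; map)
open import Data.List.Membership.Propositional using (_∈_)
open import Data.List.Relation.Unary.Unique.Propositional using (Unique)
open import Data.Nat.Base as ℕ using (ℕ; NonZero)
open import Data.Nat.Properties using (*-assoc; m*n≢0)
open import Data.Product.Base using (∃; _×_; _,_)
open import Data.Rational.Base as ℚ using (ℚ; 0ℚ)
open import Data.Sum.Base using (_⊎_; inj₁; inj₂)
open import Function.Bundles using (_⇔_; mk⇔; Equivalence)
open import Function.Properties.Equivalence using (⇔-isEquivalence)
open import Level using (Level; 0ℓ; suc; _⊔_)
open import Relation.Binary.Definitions using (_Respects_)
open import Relation.Binary.PropositionalEquality.Core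
  using (_≡_; _≢_; refl; sym; subst)
open import Relation.Binary.Structures using (IsEquivalence)
open import Relation.Nullary.Negation.Core using (¬_)
open import Relation.Unary using (Pred; U; ∅; ∁; _∩_; _⊆_)

private
  variable
    c ℓ i : Level

record ℕ⁺ : Set where
  constructor pos
  field
    value       : ℕ
    .{{nonZero}} : NonZero value

open ℕ⁺ public

infixl 7 _*⁺_

_*⁺_ : ℕ⁺ → ℕ⁺ → ℕ⁺
pos m *⁺ pos n = pos (m ℕ.* n) {{m*n≢0 m n}}

value-injective : ∀ {m n : ℕ⁺} → value m ≡ value n → m ≡ n
value-injective refl = refl

*⁺-assoc : ∀ x y z → (x *⁺ y) *⁺ z ≡ x *⁺ (y *⁺ z)
*⁺-assoc x y z = value-injective (*-assoc (value x) (value y) (value z))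

toℚ : ℕ⁺ → ℚ
toℚ n = + value n ℚ./ 1

data Dim : Set where
  finite : ℕ⁺ → Dim
  ω      : Dim

Index : Dim → Set
Index (finite n) = Fin (value n)
Index ω          = ℕ

-- `support i` may list some columns where row i vanishes; the value of
-- A x does not depend on which finite list is chosen.
record Matrix (u v : Dim) : Set where
  field
    entry            : Index u → Index v → ℚ
    support          : Index u → List (Index v)
    support-unique   : ∀ i → Unique (support i)
    support-complete : ∀ i j → entry i j ≢ 0ℚ → j ∈ support i

infixr 8 _·ᵥ_

_·ᵥ_ : ∀ {u v} → Matrix u v → (Index v → ℕ⁺) → Index u → ℚ
(A ·ᵥ x) i = foldr ℚ._+_ 0ℚ (map (λ j → entry i j ℚ.* toℚ (x j)) (support i))
  where open Matrix A

_∈ℚ_ : ℚ → Pred ℕ⁺ 0ℓ → Set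
q ∈ℚ P = ∃ λ n → q ≡ toℚ n × P n

HasImageIn : ∀ {u v} → Matrix u v → Pred ℕ⁺ 0ℓ → Set
HasImageIn A P = ∃ λ x → ∀ i → (A ·ᵥ x) i ∈ℚ P

ImagePartitionRegular : ∀ {u v} → Matrix u v → Set
ImagePartitionRegular A =
  ∀ r (colour : ℕ⁺ → Fin r) → ∃ λ k → HasImageIn A (λ n → colour n ≡ k)

record Ultrafilter : Set₁ where
  field
    sets   : Pred (Pred ℕ⁺ 0ℓ) 0ℓ
    full   : sets U
    proper : ¬ sets ∅
    inter  : ∀ {P Q} → sets P → sets Q → sets (P ∩ Q)
    upward : ∀ {P Q} → P ⊆ Q → sets P → sets Q
    ultra  : ∀ P → sets P ⊎ sets (∁ P)

open Ultrafilter

infix 4 _≈_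

_≈_ : Ultrafilter → Ultrafilter → Set₁
p ≈ q = ∀ P → sets p P ⇔ sets q P

_⁻¹*_ : ℕ⁺ → Pred ℕ⁺ 0ℓ → Pred ℕ⁺ 0ℓ
(x ⁻¹* P) y = P (x *⁺ y)

infixl 7 _·_

_·_ : Ultrafilter → Ultrafilter → Ultrafilter
p · q = record
  { sets   = λ P → sets p (λ x → sets q (x ⁻¹* P))
  ; full   = upward p (λ _ → full q) (full p)
  ; proper = λ h → proper p (upward p (λ {x} → proper q) h)
  ; inter  = λ h k → upward p (λ {x} (a , b) → inter q a b) (inter p h k)
  ; upward = λ P⊆Q → upward p (λ {x} → upward q (λ {y} → P⊆Q {x *⁺ y}))
  ; ultra  = λ P → ultra′ P (ultra p (λ x → sets q (x ⁻¹* P)))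
  }
  where
  flip-∁ : ∀ P → ∁ (λ x → sets q (x ⁻¹* P)) ⊆ (λ x → sets q (x ⁻¹* ∁ P))
  flip-∁ P {x} ¬h with ultra q (x ⁻¹* P)
  ... | inj₁ h with () ← ¬h h
  ... | inj₂ k = k

  ultra′ : ∀ P → sets p (λ x → sets q (x ⁻¹* P)) ⊎ sets p (∁ (λ x → sets q (x ⁻¹* P))) →
           sets p (λ x → sets q (x ⁻¹* P)) ⊎ sets p (λ x → sets q (x ⁻¹* ∁ P))
  ultra′ P (inj₁ h) = inj₁ h
  ultra′ P (inj₂ h) = inj₂ (upward p (λ {x} → flip-∁ P {x}) h)

≈-isEquivalence : IsEquivalence _≈_
≈-isEquivalence = record
  { refl  = λ _ → ⇔.refl
  ; sym   = λ p≈q P → ⇔.sym (p≈q P)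
  ; trans = λ p≈q q≈r P → ⇔.trans (p≈q P) (q≈r P)
  }
  where module ⇔ = IsEquivalence (⇔-isEquivalence {0ℓ})

·-cong : ∀ {p p′ q q′} → p ≈ p′ → q ≈ q′ → p · q ≈ p′ · q′
·-cong {p} {p′} {q} {q′} p≈p′ q≈q′ P = mk⇔
  (λ h → Equivalence.to (p≈p′ _) (upward p (λ {x} → Equivalence.to (q≈q′ (x ⁻¹* P))) h))
  (λ h → upward p (λ {x} → Equivalence.from (q≈q′ (x ⁻¹* P))) (Equivalence.from (p≈p′ _) h))

·-assoc : ∀ p q r → (p · q) · r ≈ p · (q · r)
·-assoc p q r P = mk⇔
  (upward p (λ {x} → upward q (λ {y} → upward r (λ {z} → subst P (*⁺-assoc x y z)))))
  (upward p (λ {x} → upward q (λ {y} → upward r (λ {z} → subst P (sym (*⁺-assoc x y z))))))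

βℕ : Semigroup (suc 0ℓ) (suc 0ℓ)
βℕ = record
  { Carrier     = Ultrafilter
  ; _≈_         = _≈_
  ; _∙_         = _·_
  ; isSemigroup = record
    { isMagma = record
      { isEquivalence = ≈-isEquivalence
      ; ∙-cong        = λ {p} {p′} {q} {q′} → ·-cong {p} {p′} {q} {q′}
      }
    ; assoc = ·-assoc
    }
  }

I : ∀ {u v} → Matrix u v → Pred Ultrafilter (suc 0ℓ)
I A p = ∀ P → sets p P → HasImageIn A P

module _ (T : Semigroup c ℓ) where
  open Semigroup T using (Carrier; _∙_) renaming (_≈_ to _≈ᵀ_)

  -- As equality is that of a setoid, subsets are the predicates
  -- respecting it.
  record IsLeftIdeal (J : Pred Carrier i) : Set (c ⊔ ℓ ⊔ i) where
    field
      respects : J Respects _≈ᵀ_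
      nonempty : ∃ J
      closedˡ  : ∀ t {x} → J x → J (t ∙ x)

  record IsRightIdeal (J : Pred Carrier i) : Set (c ⊔ ℓ ⊔ i) where
    field
      respects : J Respects _≈ᵀ_
      nonempty : ∃ J
      closedʳ  : ∀ t {x} → J x → J (x ∙ t)

  IsTwoSidedIdeal : Pred Carrier i → Set (c ⊔ ℓ ⊔ i)
  IsTwoSidedIdeal J = IsLeftIdeal J × IsRightIdeal J

{-# OPTIONS --safe #-}
-- Over ℕ⁺, multiplication by a scalar commutes with A, which gives the ideal
-- laws; for the right ideal law one scalar must serve all rows, hence finiteness.
-- For nonemptiness, call P regular if every finite colouring has a colour class
-- whose intersection with P contains an image of A.  Regularity passes to one
-- of the two parts of any partition, so a maximal family all of whose finite
-- intersections are regular is an ultrafilter, and it lies in I(A).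
module Submission where

open import Defs
open import Axiom.ExcludedMiddle using (ExcludedMiddle)
open import Axiom.Extensionality.Propositional using (Extensionality)
open import Data.Bool.Base using (Bool; true; false; T)
open import Data.Empty using (⊥-elim)
open import Data.Fin.Base using (Fin; zero; suc; join; splitAt)
open import Data.Fin.Properties using (splitAt-join)
open import Data.Integer.Base using (+_)
import Data.Integer.Properties as ℤ
open import Data.List.Base using (List; []; _∷_; _++_; foldr; map)
open import Data.List.Relation.Binary.Subset.Propositional using (_⊆_)
open import Data.List.Relation.Binary.Subset.Propositional.Properties using (∷⁺ʳ; xs⊆x∷xs)
open import Data.List.Relation.Unary.All using (All; []; _∷_)
import Data.List.Relation.Unary.All as All
import Data.List.Relation.Unary.All.Properties as All
open import Data.List.Relation.Unary.Any using (here; there)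
open import Data.Nat.Base using (ℕ; zero; suc)
open import Data.Nat.Properties using (*-comm)
open import Data.Product.Base using (_×_; ∃; _,_; proj₁; proj₂; map₂)
import Data.Rational.Base as ℚ
import Data.Rational.Properties as ℚ
import Data.Rational.Unnormalised.Base as ℚᵘ
import Data.Rational.Unnormalised.Properties as ℚᵘ
open import Data.Sum.Base using (_⊎_; inj₁; inj₂; [_,_]′)
import Data.Sum.Base as Sum
open import Data.Unit.Base using (tt)
open import Function.Base using (_∘_; id)
open import Function.Bundles using (Equivalence)
open import Level using (0ℓ)
open import Relation.Binary.PropositionalEquality
  using (_≡_; refl; sym; trans; cong; cong₂; subst; module ≡-Reasoning)
open import Relation.Nullary using (¬_; yes; no)
open import Relation.Nullary.Decidable using (⌊_⌋; toWitness; fromWitness)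
import Relation.Unary as Unary
open Unary using (Pred; U; ∅; ∁; _∩_; _∪_)

open Ultrafilter

-- Scaling a vector by a positive integer.

*⁺-comm : ∀ x y → x *⁺ y ≡ y *⁺ x
*⁺-comm x y = value-injective (*-comm (value x) (value y))

-- Among unnormalised rationals no fraction has to be reduced: over denominator 1 the product is
-- that of the numerators.
toℚ-*⁺ : ∀ x y → toℚ (x *⁺ y) ≡ toℚ x ℚ.* toℚ y
toℚ-*⁺ x y = ℚ.toℚᵘ-injective (begin
  ℚ.toℚᵘ (toℚ (x *⁺ y))                     ≈⟨ ℚ.toℚᵘ-fromℚᵘ (ℚᵘ.mkℚᵘ (+ value (x *⁺ y)) 0) ⟩
  ℚᵘ.mkℚᵘ (+ value (x *⁺ y)) 0              ≡⟨ cong (λ i → ℚᵘ.mkℚᵘ i 0) (ℤ.pos-* (value x) (value y)) ⟩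
  ℚᵘ.mkℚᵘ (+ value x) 0 ℚᵘ.* ℚᵘ.mkℚᵘ (+ value y) 0
    ≈⟨ ℚᵘ.*-cong (ℚ.toℚᵘ-fromℚᵘ (ℚᵘ.mkℚᵘ (+ value x) 0)) (ℚ.toℚᵘ-fromℚᵘ (ℚᵘ.mkℚᵘ (+ value y) 0)) ⟨
  ℚ.toℚᵘ (toℚ x) ℚᵘ.* ℚ.toℚᵘ (toℚ y)        ≈⟨ ℚ.toℚᵘ-homo-* (toℚ x) (toℚ y) ⟨
  ℚ.toℚᵘ (toℚ x ℚ.* toℚ y)                  ∎)
  where open ℚᵘ.≃-Reasoning

·ᵥ-scale : ∀ {u v} (A : Matrix u v) c x i →
           (A ·ᵥ λ j → c *⁺ x j) i ≡ toℚ c ℚ.* (A ·ᵥ x) i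
·ᵥ-scale A c x i = sum (support i)
  where
  open Matrix A
  open ≡-Reasoning

  term : ∀ j → entry i j ℚ.* toℚ (c *⁺ x j) ≡ toℚ c ℚ.* (entry i j ℚ.* toℚ (x j))
  term j = begin
    entry i j ℚ.* toℚ (c *⁺ x j)            ≡⟨ cong (entry i j ℚ.*_) (toℚ-*⁺ c (x j)) ⟩
    entry i j ℚ.* (toℚ c ℚ.* toℚ (x j))     ≡⟨ ℚ.*-assoc (entry i j) _ _ ⟨
    (entry i j ℚ.* toℚ c) ℚ.* toℚ (x j)     ≡⟨ cong (ℚ._* toℚ (x j)) (ℚ.*-comm (entry i j) (toℚ c)) ⟩
    (toℚ c ℚ.* entry i j) ℚ.* toℚ (x j)     ≡⟨ ℚ.*-assoc (toℚ c) _ _ ⟩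
    toℚ c ℚ.* (entry i j ℚ.* toℚ (x j))     ∎

  sum : ∀ js → foldr ℚ._+_ ℚ.0ℚ (map (λ j → entry i j ℚ.* toℚ (c *⁺ x j)) js) ≡
               toℚ c ℚ.* foldr ℚ._+_ ℚ.0ℚ (map (λ j → entry i j ℚ.* toℚ (x j)) js)
  sum []       = sym (ℚ.*-zeroʳ (toℚ c))
  sum (j ∷ js) = trans (cong₂ ℚ._+_ (term j) (sum js)) (sym (ℚ.*-distribˡ-+ (toℚ c) _ _))

-- Images inside a set.

HasImageIn-map : ∀ {u v} (A : Matrix u v) {P Q} → P Unary.⊆ Q → HasImageIn A P → HasImageIn A Q
HasImageIn-map A P⊆Q = map₂ λ h i → map₂ (map₂ P⊆Q) (h i)

-- The condition refers to the entries of the given image, so it serves both a scalar fixed before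
-- `x` is found and one chosen afterwards from those entries.
HasImageIn-scale : ∀ {u v} (A : Matrix u v) {P : Pred ℕ⁺ 0ℓ} c →
                   ((x , h) : HasImageIn A U) → (∀ i → P (c *⁺ proj₁ (h i))) → HasImageIn A P
HasImageIn-scale A c (x , h) k = (λ j → c *⁺ x j) , λ i →
  let n , eq , _ = h i in
  c *⁺ n , trans (·ᵥ-scale A c x i) (trans (cong (toℚ c ℚ.*_) eq) (sym (toℚ-*⁺ c n))) , k i

-- Every matrix has a row, so no image fits into the empty set; this will make the constructed
-- ultrafilter proper.
someIndex : ∀ u → Index u
someIndex (finite (pos (suc n)))    = zero
someIndex (finite (pos zero {{()}}))
someIndex ω                         = zero

HasImageIn-∅ : ∀ {u v} (A : Matrix u v) → ¬ HasImageIn A ∅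
HasImageIn-∅ {u} A (x , h) = proj₂ (proj₂ (h (someIndex u)))

-- Used with one set per row of a finite matrix, to find a scalar good for all rows at once.
sets-⋂ : ∀ (p : Ultrafilter) {k} (Q : Fin k → Pred ℕ⁺ 0ℓ) →
         (∀ i → sets p (Q i)) → sets p (λ n → ∀ i → Q i n)
sets-⋂ p {zero}  Q h = upward p (λ _ ()) (full p)
sets-⋂ p {suc k} Q h =
  upward p (λ { (a , b) zero → a ; (a , b) (suc i) → b i })
    (inter p (h zero) (sets-⋂ p (Q ∘ suc) (h ∘ suc)))

I-respects : ∀ {u v} (A : Matrix u v) {p q} → p ≈ q → I A p → I A q
I-respects A p≈q p∈I P P∈q = p∈I P (Equivalence.from (p≈q P) P∈q)

-- Excluded middle for all types in Set yields elements, so it is also a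
-- choice operator.
module Classical (em : ExcludedMiddle 0ℓ) where

  -- Closure of `I A` under multiplication.

  sets-inhabited : ∀ (p : Ultrafilter) {P} → sets p P → ∃ P
  sets-inhabited p {P} P∈p with em {∃ P}
  ... | yes n∈P  = n∈P
  ... | no empty = ⊥-elim (proper p (upward p (λ {n} n∈P → empty (n , n∈P)) P∈p))

  I-closedˡ : ∀ {u v} (A : Matrix u v) t {p} → I A p → I A (t · p)
  I-closedˡ A t p∈I P P∈tp =
    -- Membership of `P` in `t · p` provides a scalar `c` with `c ⁻¹* P` in `p`; an image inside
    -- that set, scaled by `c`, lands in `P`.
    let c , cP∈p = sets-inhabited t P∈tp
        x , h    = p∈I _ cP∈p
    in HasImageIn-scale A {P} c (x , map₂ (map₂ _) ∘ h) (proj₂ ∘ proj₂ ∘ h)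

  I-closedʳ : ∀ {m v} (A : Matrix (finite m) v) t {p} → I A p → I A (p · t)
  I-closedʳ A t p∈I P P∈pt =
    -- Each entry `n` of this image satisfies `n ⁻¹* P` in `t`; a common point `c` of these finitely
    -- many sets is the scalar.
    let x , h = p∈I _ P∈pt
        c , k = sets-inhabited t (sets-⋂ t (λ i → proj₁ (h i) ⁻¹* P) (proj₂ ∘ proj₂ ∘ h))
    in HasImageIn-scale A {P} c (x , map₂ (map₂ _) ∘ h)
         λ i → subst P (*⁺-comm (proj₁ (h i)) c) (k i)

  -- Boolean values keep the powerset and its iterates in `Set`, within reach of `em`, and turn
  -- mutual inclusion into equality by extensionality.
  Subset : Set → Set
  Subset S = S → Bool

  infix 4 _∋_ _⊑_

  _∋_ : ∀ {S} → Subset S → S → Set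
  F ∋ a = T (F a)

  _⊑_ : ∀ {S} → Subset S → Subset S → Set
  F ⊑ G = ∀ a → F ∋ a → G ∋ a

  -- Opaque, so that P can be inferred from χ P.
  opaque
    χ : ∀ {S} → Pred S 0ℓ → Subset S
    χ P a = ⌊ em {P a} ⌋

    ∋χ⁺ : ∀ {S} {P : Pred S 0ℓ} {a} → P a → χ P ∋ a
    ∋χ⁺ = fromWitness

    ∋χ⁻ : ∀ {S} {P : Pred S 0ℓ} {a} → χ P ∋ a → P a
    ∋χ⁻ = toWitness

  -- The Teichmüller–Tukey lemma, by transfinite addition of single elements.
  module Tukey (ext : Extensionality 0ℓ 0ℓ) {S : Set} (Con : List S → Set)
               (con-[] : Con []) (con-⊆ : ∀ {k l} → k ⊆ l → Con l → Con k) where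

    ⊑-trans : {F G H : Subset S} → F ⊑ G → G ⊑ H → F ⊑ H
    ⊑-trans f g a = g a ∘ f a

    ⊑-antisym : {F G : Subset S} → F ⊑ G → G ⊑ F → F ≡ G
    ⊑-antisym {F} {G} f g = ext λ a → T-antisym (F a) (G a) (f a) (g a)
      where
      T-antisym : ∀ b c → (T b → T c) → (T c → T b) → b ≡ c
      T-antisym true  true  _ _ = refl
      T-antisym false false _ _ = refl
      T-antisym true  false f _ = ⊥-elim (f tt)
      T-antisym false true  _ g = ⊥-elim (g tt)

    -- Consistent sets and one-element extensions.

    Consistent : Subset S → Set
    Consistent F = ∀ l → All (F ∋_) l → Con l

    ConsistentWith : S → Subset S → Set
    ConsistentWith a F = ∀ l → All (F ∋_) l → Con (a ∷ l)

    Extension : Subset S → Set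
    Extension F = ∃ λ a → ¬ F ∋ a × ConsistentWith a F

    next : Subset S → Subset S
    next F with em {Extension F}
    ... | yes (a , _) = χ λ b → F ∋ b ⊎ b ≡ a
    ... | no _        = F

    ⊑-next : ∀ F → F ⊑ next F
    ⊑-next F b b∈F with em {Extension F}
    ... | yes _ = ∋χ⁺ (inj₁ b∈F)
    ... | no _  = b∈F

    -- `next F` has at most one new element `a`, so whether `a` lies in `G` decides.
    nothing-between : ∀ {F G} → F ⊑ G → G ⊑ next F → G ⊑ F ⊎ next F ⊑ G
    nothing-between {F} {G} F⊑G G⊑F⁺ with em {Extension F}
    ... | no _ = inj₁ G⊑F⁺
    ... | yes (a , _) with em {G ∋ a}
    ...   | yes a∈G = inj₂ λ b → [ F⊑G b , (λ { refl → a∈G }) ]′ ∘ ∋χ⁻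
    ...   | no a∉G  = inj₁ λ b b∈G → [ id , (λ { refl → ⊥-elim (a∉G b∈G) }) ]′ (∋χ⁻ (G⊑F⁺ b b∈G))

    next-consistent : ∀ F → Consistent F → Consistent (next F)
    next-consistent F con l l⊑F⁺ with em {Extension F}
    ... | no _ = con l l⊑F⁺
    ... | yes (a , _ , a-con) =
      let l′ , l′⊑F , l⊆ = separate l l⊑F⁺ in con-⊆ l⊆ (a-con l′ l′⊑F)
      where
      -- Discarding the occurrences of `a` from `l` leaves a list inside `F`, to which `a-con`
      -- applies.
      separate : ∀ l → All ((χ λ b → F ∋ b ⊎ b ≡ a) ∋_) l →
                 ∃ λ l′ → All (F ∋_) l′ × l ⊆ a ∷ l′
      separate []      []       = [] , [] , λ ()
      separate (b ∷ l) (h ∷ hs) with separate l hs | ∋χ⁻ h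
      ... | l′ , l′⊑F , l⊆ | inj₁ b∈F = b ∷ l′ , b∈F ∷ l′⊑F , λ where
        (here refl) → there (here refl)
        (there c∈l) → ∷⁺ʳ a (xs⊆x∷xs l′ b) (l⊆ c∈l)
      ... | l′ , l′⊑F , l⊆ | inj₂ refl = l′ , l′⊑F , λ where
        (here refl) → here refl
        (there c∈l) → l⊆ c∈l

    -- The tower and its linearity.

    ⋃ : Subset (Subset S) → Subset S
    ⋃ C = χ λ a → ∃ λ F → C ∋ F × F ∋ a

    -- The least family closed under `next` and unions; the empty union is its starting point. Any
    -- subfamily may be united, since `tower-linear` shows the tower to be a chain.
    data Tower : Subset S → Set where
      step : ∀ {F} → Tower F → Tower (next F)
      sup  : ∀ C → (∀ F → C ∋ F → Tower F) → Tower (⋃ C)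

    next-compare : ∀ {F G} → F ⊑ G ⊎ next G ⊑ F → G ⊑ next F → next F ⊑ G ⊎ next G ⊑ next F
    next-compare {F} (inj₂ G⁺⊑F) _ = inj₂ (⊑-trans G⁺⊑F (⊑-next F))
    next-compare {F} {G} (inj₁ F⊑G) G⊑F⁺ with nothing-between F⊑G G⊑F⁺
    ... | inj₂ F⁺⊑G = inj₁ F⁺⊑G
    -- `next` need not be monotone, so inclusions between `F` and `G` must first become an equality.
    ... | inj₁ G⊑F  = inj₂ (subst (λ H → next G ⊑ next H) (⊑-antisym G⊑F F⊑G) λ _ → id)

    ⋃-compare : ∀ C {H K} → (∀ F → C ∋ F → H ⊑ F ⊎ F ⊑ K) → H ⊑ ⋃ C ⊎ ⋃ C ⊑ K
    ⋃-compare C {H} compare with em {∃ λ F → C ∋ F × H ⊑ F}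
    ... | yes (F , F∈C , H⊑F) = inj₁ λ a a∈H → ∋χ⁺ (F , F∈C , H⊑F a a∈H)
    ... | no ¬above = inj₂ λ a a∈⋃ →
      let F , F∈C , a∈F = ∋χ⁻ a∈⋃ in
      [ (λ H⊑F → ⊥-elim (¬above (F , F∈C , H⊑F))) , (λ F⊑K → F⊑K a a∈F) ]′ (compare F F∈C)

    -- Double induction. The alternative `next G ⊑ F`, stronger than `G ⊑ F`, is what carries the
    -- successor cases: recursion on the second tower leaves either the claim or `G ⊑ next F`, and
    -- then `next-compare` finishes from the comparison with `F`.
    tower-linear : ∀ {F G} → Tower F → Tower G → F ⊑ G ⊎ next G ⊑ F
    tower-linear (sup C t) s =
      Sum.swap (⋃-compare C λ F F∈C → Sum.swap (tower-linear (t F F∈C) s))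
    tower-linear (step t) (step s) =
      [ (λ F⁺⊑G → inj₁ (⊑-trans F⁺⊑G (⊑-next _))) , next-compare (tower-linear t (step s)) ]′
        (tower-linear (step t) s)
    tower-linear (step t) (sup D s) =
      [ inj₁ , next-compare (tower-linear t (sup D s)) ]′
        (⋃-compare D λ G G∈D → Sum.map₂ (⊑-trans (⊑-next G)) (tower-linear (step t) (s G G∈D)))

    -- In a chain, finitely many members have a largest one. The given `F` is the answer for the
    -- empty list.
    tower-directed : ∀ C → (∀ F → C ∋ F → Tower F) → ∀ {F} → C ∋ F → ∀ l → All (⋃ C ∋_) l →
                     ∃ λ G → C ∋ G × F ⊑ G × All (G ∋_) l
    tower-directed C t {F} F∈C [] [] = F , F∈C , (λ _ → id) , []
    tower-directed C t {F} F∈C (a ∷ l) (h ∷ hs) with tower-directed C t F∈C l hs | ∋χ⁻ h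
    ... | G , G∈C , F⊑G , l⊑G | H , H∈C , a∈H with tower-linear (t H H∈C) (t G G∈C)
    ...   | inj₁ H⊑G = G , G∈C , F⊑G , H⊑G a a∈H ∷ l⊑G
    ...   | inj₂ G⁺⊑H = H , H∈C , ⊑-trans F⊑G G⊑H , a∈H ∷ All.map (G⊑H _) l⊑G
      where G⊑H = ⊑-trans (⊑-next G) G⁺⊑H

    tower-consistent : ∀ {F} → Tower F → Consistent F
    tower-consistent (step t)  l       l⊑F      = next-consistent _ (tower-consistent t) l l⊑F
    -- `C` may be empty, so no member of it can be called upon.
    tower-consistent (sup C t) []      _        = con-[]
    tower-consistent (sup C t) (a ∷ l) (h ∷ hs) =
      let F , F∈C , a∈F       = ∋χ⁻ h
          G , G∈C , F⊑G , l⊑G = tower-directed C t F∈C l hs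
      in tower-consistent (t G G∈C) (a ∷ l) (F⊑G a a∈F ∷ l⊑G)

    -- The maximal consistent set.

    top : Subset S
    top = ⋃ (χ Tower)

    -- The family united may be the whole tower, so `top` is its largest member and `next` cannot
    -- enlarge it.
    top-tower : Tower top
    top-tower = sup (χ Tower) λ _ → ∋χ⁻

    top-consistent : Consistent top
    top-consistent = tower-consistent top-tower

    top-maximal : ∀ a → ConsistentWith a top → top ∋ a
    top-maximal a a-con with em {top ∋ a}
    ... | yes a∈top = a∈top
    ... | no a∉top  = ⊥-elim (no-extension (a , a∉top , a-con))
      where
      next-top⊑top : next top ⊑ top
      next-top⊑top b b∈ = ∋χ⁺ (next top , ∋χ⁺ (step top-tower) , b∈)

      no-extension : ¬ Extension top
      no-extension e with em {Extension top} | next-top⊑top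
      ... | no ¬e              | _   = ¬e e
      ... | yes (b , b∉top , _) | ≤top = b∉top (≤top b (∋χ⁺ (inj₂ refl)))

  -- Regular sets and their partitions.

  module _ {u v} (A : Matrix u v) where

    Regular : Pred ℕ⁺ 0ℓ → Set
    Regular P = ∀ r (colour : ℕ⁺ → Fin r) → ∃ λ k → HasImageIn A (P ∩ λ n → colour n ≡ k)

    regular-⊆ : ∀ {P Q} → P Unary.⊆ Q → Regular P → Regular Q
    regular-⊆ P⊆Q reg r colour =
      map₂ (HasImageIn-map A λ (n∈P , eq) → P⊆Q n∈P , eq) (reg r colour)

    regular⇒image : ∀ {P} → Regular P → HasImageIn A P
    regular⇒image reg = HasImageIn-map A proj₁ (proj₂ (reg 1 λ _ → zero))

    -- Colour `P` by `c` and everything else by `d`, with disjoint palettes. An image in one colour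
    -- class then lies wholly in `P`, or wholly outside `P` and hence in `Q`.
    combine-colours : ∀ {P Q r s} → Regular (P ∪ Q) → (c : ℕ⁺ → Fin r) (d : ℕ⁺ → Fin s) →
      (∃ λ k → HasImageIn A (P ∩ λ n → c n ≡ k)) ⊎ (∃ λ k → HasImageIn A (Q ∩ λ n → d n ≡ k))
    combine-colours {P} {Q} {r} {s} reg c d =
      let k , h = reg _ (join r s ∘ side) in
      split (splitAt r k)
        (HasImageIn-map A
          (λ {n} (n∈ , eq) → n∈ , trans (sym (splitAt-join r s (side n))) (cong (splitAt r) eq)) h)
      where
      side : ℕ⁺ → Fin r ⊎ Fin s
      side n with em {P n}
      ... | yes _ = inj₁ (c n)
      ... | no _  = inj₂ (d n)

      onP : ∀ k → (P ∪ Q) ∩ (λ n → side n ≡ inj₁ k) Unary.⊆ P ∩ λ n → c n ≡ k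
      onP k {n} (_ , eq) with em {P n} | eq
      ... | yes n∈P | refl = n∈P , refl

      onQ : ∀ k → (P ∪ Q) ∩ (λ n → side n ≡ inj₂ k) Unary.⊆ Q ∩ λ n → d n ≡ k
      onQ k {n} (n∈ , eq) with em {P n} | n∈ | eq
      ... | no n∉P | inj₁ n∈P | _    = ⊥-elim (n∉P n∈P)
      ... | no _   | inj₂ n∈Q | refl = n∈Q , refl

      split : ∀ e → HasImageIn A ((P ∪ Q) ∩ λ n → side n ≡ e) → _
      split (inj₁ k) h = inj₁ (k , HasImageIn-map A (onP k) h)
      split (inj₂ k) h = inj₂ (k , HasImageIn-map A (onQ k) h)

    -- If some colouring `d` were bad for `Q`, pairing it with an arbitrary `c` would make every `c`
    -- good for `P`.
    regular-split : ∀ {P Q} → Regular (P ∪ Q) → Regular P ⊎ Regular Q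
    regular-split {P} {Q} reg with em {Regular P}
    ... | yes regP = inj₁ regP
    ... | no ¬regP = inj₂ regQ
      where
      regQ : Regular Q
      regQ s d with em {∃ λ k → HasImageIn A (Q ∩ λ n → d n ≡ k)}
      ... | yes h = h
      ... | no ¬h = ⊥-elim (¬regP λ r c → [ id , ⊥-elim ∘ ¬h ]′ (combine-colours reg c d))

    -- An ultrafilter of regular sets.

    module _ (ext : Extensionality 0ℓ 0ℓ) (ipr : ImagePartitionRegular A) where

      ⋂ : List (Subset ℕ⁺) → Pred ℕ⁺ 0ℓ
      ⋂ l n = All (_∋ n) l

      open Tukey ext (Regular ∘ ⋂)
        -- The empty intersection is all of `ℕ⁺`, whose regularity is the image partition regularity
        -- of `A`.
        (λ r c → map₂ (HasImageIn-map A λ eq → [] , eq) (ipr r c))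
        (λ k⊆l → regular-⊆ (All.anti-mono k⊆l))

      -- By maximality: `⋂ (l ++ k)` is regular and contained in `⋂ (χ P ∷ k)`. The filter laws
      -- `full`, `inter` and `upward` are the cases of zero, two and one sets in `l`.
      top-closed : ∀ {P} l → All (top ∋_) l → ⋂ l Unary.⊆ P → top ∋ χ P
      top-closed l l⊑top l⊆P = top-maximal _ λ k k⊑top →
        regular-⊆ (λ h → ∋χ⁺ (l⊆P (All.++⁻ˡ l h)) ∷ All.++⁻ʳ l h)
          (top-consistent (l ++ k) (All.++⁺ l⊑top k⊑top))

      top-image : ∀ P → top ∋ χ P → HasImageIn A P
      top-image P P∈top = HasImageIn-map A (∋χ⁻ ∘ All.head)
        (regular⇒image (top-consistent (χ P ∷ []) (P∈top ∷ [])))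

      -- If lists `k` and `l` from `top` were inconsistent with `χ P` and `χ (∁ P)` respectively,
      -- splitting the regular set `⋂ (k ++ l)` along `P` would contradict `regular-split`.
      top-ultra : ∀ P → top ∋ χ P ⊎ top ∋ χ (∁ P)
      top-ultra P with em {ConsistentWith (χ P) top}
      ... | yes P-con = inj₁ (top-maximal _ P-con)
      ... | no ¬P-con = inj₂ (top-maximal _ ∁P-con)
        where
        cover : ∀ k l → ⋂ (k ++ l) Unary.⊆ ⋂ (χ P ∷ k) ∪ ⋂ (χ (∁ P) ∷ l)
        cover k l {n} h with em {P n}
        ... | yes n∈P = inj₁ (∋χ⁺ n∈P ∷ All.++⁻ˡ k h)
        ... | no n∉P  = inj₂ (∋χ⁺ n∉P ∷ All.++⁻ʳ k h)

        ∁P-con : ConsistentWith (χ (∁ P)) top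
        ∁P-con l l⊑top with em {Regular (⋂ (χ (∁ P) ∷ l))}
        ... | yes reg = reg
        ... | no ¬reg = ⊥-elim (¬P-con λ k k⊑top →
          [ id , ⊥-elim ∘ ¬reg ]′ (regular-split (regular-⊆ (cover k l)
            (top-consistent (k ++ l) (All.++⁺ k⊑top l⊑top)))))

      topUltrafilter : Ultrafilter
      topUltrafilter = record
        { sets   = λ P → top ∋ χ P
        ; full   = top-closed [] [] _
        ; proper = HasImageIn-∅ A ∘ top-image ∅
        ; inter  = λ P∈ Q∈ → top-closed _ (P∈ ∷ Q∈ ∷ [])
                     λ { (n∈P ∷ n∈Q ∷ []) → ∋χ⁻ n∈P , ∋χ⁻ n∈Q }
        ; upward = λ P⊆Q P∈ → top-closed _ (P∈ ∷ []) (P⊆Q ∘ ∋χ⁻ ∘ All.head)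
        ; ultra  = top-ultra
        }

      I-nonempty : ∃ (I A)
      I-nonempty = topUltrafilter , top-image

  -- The ideal properties.

  module _ (ext : Extensionality 0ℓ 0ℓ) where

    I-isLeftIdeal : ∀ {u v} (A : Matrix u v) → ImagePartitionRegular A → IsLeftIdeal βℕ (I A)
    I-isLeftIdeal A ipr = record
      { respects = λ {p} {q} → I-respects A {p} {q}
      ; nonempty = I-nonempty A ext ipr
      ; closedˡ  = λ t {p} → I-closedˡ A t {p}
      }

    I-isRightIdeal : ∀ {m v} (A : Matrix (finite m) v) →
                     ImagePartitionRegular A → IsRightIdeal βℕ (I A)
    I-isRightIdeal A ipr = record
      { respects = λ {p} {q} → I-respects A {p} {q}
      ; nonempty = I-nonempty A ext ipr
      ; closedʳ  = λ t {p} → I-closedʳ A t {p}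
      }

lemma2p3 : ExcludedMiddle 0ℓ → Extensionality 0ℓ 0ℓ →
    (∀ {u v} (A : Matrix u v) →
    ImagePartitionRegular A → IsLeftIdeal βℕ (I A)) ×
    (∀ {m n} (A : Matrix (finite m) (finite n)) →
    ImagePartitionRegular A → IsTwoSidedIdeal βℕ (I A))
lemma2p3 em ext =
  I-isLeftIdeal ext , λ A ipr → I-isLeftIdeal ext A ipr , I-isRightIdeal ext A ipr
  where open Classical em
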